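{- Let $w\ge -1$ be an integer. Every $\mathbf{Y}$-frieze pattern of width $w$ is the image, under the map $p_w:\operatorname{Frieze}(w)\to\operatorname{YFrieze}(w)$, of a frieze pattern of width $w$; that is, $p_w$ is surjective.
   Context: Let $w\ge -1$ be an integer. A frieze pattern $A$ of width $w$ is an integer array $(a_{i,j})_{i,j\in\mathbb{Z},\,-3\le j-i\le w+2}$ such that: (1) for all $i\in\mathbb{Z}$, $a_{i,i-3}=a_{i,i+w+2}=-1$, $a_{i,i-1}=a_{i,i+w}=1$ and $a_{i,i-2}=a_{i,i+w+1}=0$; (2) $a_{i,j}$ is a positive integer whenever $0\le j-i\le w-1$; (3) (diamond rule) $a_{i,j}a_{i+1,j+1}=1+a_{i,j+1}a_{i+1,j}$ whenever $-2\le j-i\le w+1$. The set of all of these is $\operatorname{Frieze}(w)$. A $\mathbf{Y}$-frieze pattern $B$ of width $w$ is an integer array $(b_{i,j})_{i,j\in\mathbb{Z},\,-3\le j-i\le w+2}$ such that: (1) for all $i\in\mathbb{Z}$, $b_{i,i-3}=b_{i,i-1}=b_{i,i+w}=b_{i,i+w+2}=0$ and $b_{i,i-2}=b_{i,i+w+1}=-1$; (2) $b_{i,j}$ is a positive integer whenever $0\le j-i\le w-1$; (3) ($\mathbf{Y}$-diamond rule) $b_{i,j}b_{i+1,j+1}=(1+b_{i,j+1})(1+b_{i+1,j})$ whenever $-2\le j-i\le w+1$. The set of all of these is $\operatorname{YFrieze}(w)$. The map $p_w:\operatorname{Frieze}(w)\to\operatorname{YFrieze}(w)$ sends $A=(a_{i,j})$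 to the unique $B=(b_{i,j})\in\operatorname{YFrieze}(w)$ with $b_{i,i}=a_{i,i+1}$ for all $i\in\mathbb{Z}$ (such a $B$ exists, by earlier work of de Saint Germain, and is determined by its entries $b_{i,i}$). -}

module Defs where

open import Data.Integer
  using (ℤ; +_; 0ℤ; 1ℤ; -1ℤ; _+_; _-_; _*_; -_; ∣_∣; _≤_; _<_; +<+;
         NonZero; >-nonZero; positive)
open import Data.Integer.Properties
open import Algebra.Properties.AbelianGroup +-0-abelianGroup using (∙-cancelˡ)
open import Data.Integer.Tactic.RingSolver using (solve-∀)
open import Data.Nat.Base as ℕ using (ℕ; suc)
open import Data.Product using (_,_; proj₁; proj₂; _×_; ∃!)
open import Relation.Binary.PropositionalEquality
open import Relation.Nullary using (yes; no)

-- An array (x_{i,j}) with -3 ≤ j - i ≤ w + 2 is represented by a total function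
-- on ℤ × ℤ whose values outside that strip carry no meaning: the axioms below
-- only constrain entries in the strip, and arrays are compared by _≈[ w ]_.
Array : Set
Array = ℤ → ℤ → ℤ

InStrip : ℤ → ℤ → ℤ → Set
InStrip w i j = (- + 3 ≤ j - i) × (j - i ≤ w + + 2)

_≈[_]_ : Array → ℤ → Array → Set
x ≈[ w ] y = ∀ i j → InStrip w i j → x i j ≡ y i j

record IsFrieze (w : ℤ) (a : Array) : Set where
  field
    [i,i-3]   : ∀ i → a i (i - + 3) ≡ -1ℤ
    [i,i-2]   : ∀ i → a i (i - + 2) ≡ 0ℤ
    [i,i-1]   : ∀ i → a i (i - + 1) ≡ 1ℤ
    [i,i+w]   : ∀ i → a i (i + w) ≡ 1ℤ
    [i,i+w+1] : ∀ i → a i (i + w + + 1) ≡ 0ℤ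
    [i,i+w+2] : ∀ i → a i (i + w + + 2) ≡ -1ℤ
    pos       : ∀ i j → 0ℤ ≤ j - i → j - i ≤ w - + 1 → 0ℤ < a i j
    diamond   : ∀ i j → - + 2 ≤ j - i → j - i ≤ w + + 1 →
                a i j * a (i + + 1) (j + + 1) ≡
                1ℤ + a i (j + + 1) * a (i + + 1) j

record IsYFrieze (w : ℤ) (b : Array) : Set where
  field
    [i,i-3]   : ∀ i → b i (i - + 3) ≡ 0ℤ
    [i,i-2]   : ∀ i → b i (i - + 2) ≡ -1ℤ
    [i,i-1]   : ∀ i → b i (i - + 1) ≡ 0ℤ
    [i,i+w]   : ∀ i → b i (i + w) ≡ 0ℤ
    [i,i+w+1] : ∀ i → b i (i + w + + 1) ≡ -1ℤ
    [i,i+w+2] : ∀ i → b i (i + w + + 2) ≡ 0ℤ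
    pos       : ∀ i j → 0ℤ ≤ j - i → j - i ≤ w - + 1 → 0ℤ < b i j
    diamond   : ∀ i j → - + 2 ≤ j - i → j - i ≤ w + + 1 →
                b i j * b (i + + 1) (j + + 1) ≡
                (1ℤ + b i (j + + 1)) * (1ℤ + b (i + + 1) j)

record Frieze (w : ℤ) : Set where
  constructor _,_
  field
    entry    : Array
    isFrieze : IsFrieze w entry
  open IsFrieze isFrieze public

record YFrieze (w : ℤ) : Set where
  constructor _,_
  field
    entry     : Array
    isYFrieze : IsYFrieze w entry
  open IsYFrieze isYFrieze public

_≈F_ : ∀ {w} → Frieze w → Frieze w → Set
_≈F_ {w} A A′ = Frieze.entry A ≈[ w ] Frieze.entry A′

_≈Y_ : ∀ {w} → YFrieze w → YFrieze w → Set
_≈Y_ {w} B B′ = YFrieze.entry B ≈[ w ] YFrieze.entry B′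

_MapsTo_ : ∀ {w} → Frieze w → YFrieze w → Set
A MapsTo B = ∀ i → YFrieze.entry B i i ≡ Frieze.entry A i (i + + 1)

private
  -- c ≤ d follows from a ≤ b when d - c exceeds b - a by a natural number.
  lin : ∀ {a b c d} n → a ≤ b → d - c ≡ (b - a) + + n → c ≤ d
  lin n a≤b eq = 0≤i-j⇒j≤i
    (subst (0ℤ ≤_) (sym eq) (≤-trans (i≤j⇒0≤j-i a≤b) (i≤i+j _ (+ n))))

  strict : ∀ {a b} → a ≤ b → b ≢ a → a + + 1 ≤ b
  strict {a} a≤b b≢a = subst (_≤ _) (+-comm (+ 1) a)
    (i<j⇒suc[i]≤j (≤∧≢⇒< a≤b (λ e → b≢a (sym e))))

  offset : ∀ {i j c} → j - i ≡ c → j ≡ i + c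
  offset {i} {j} e = trans (split i j) (cong (λ d → i + d) e)
    where
    split : ∀ i j → j ≡ i + (j - i)
    split = solve-∀

  0<1 : 0ℤ < 1ℤ
  0<1 = +<+ (ℕ.s≤s ℕ.z≤n)

  *-pos : ∀ {x y} → 0ℤ < x → 0ℤ < y → 0ℤ < x * y
  *-pos {x} {y} 0<x 0<y = subst (_< x * y) (*-zeroʳ x)
    (*-monoˡ-<-pos x ⦃ positive 0<x ⦄ 0<y)

  module FriezeLemmas {w} (A : Frieze w) where
    open Frieze A renaming (entry to a)

    positive′ : ∀ i j → - + 1 ≤ j - i → j - i ≤ w → 0ℤ < a i j
    positive′ i j lo hi with j - i ≟ - + 1
    ... | yes e = subst (0ℤ <_)
                    (sym (trans (cong (a i) (offset e)) ([i,i-1] i))) 0<1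
    ... | no ≢-1 with j - i ≟ w
    ... | yes e = subst (0ℤ <_)
                    (sym (trans (cong (a i) (offset e)) ([i,i+w] i))) 0<1
    ... | no ≢w = pos i j (strict lo ≢-1)
                    (lin 0 (strict hi (λ e → ≢w (sym e))) (arith w (j - i)))
      where
      arith : ∀ w d → (w - + 1) - d ≡ (w - (d + + 1)) + + 0
      arith = solve-∀

    b : Array
    b i j = a i (j + + 1) * a (i + + 1) j

    at : ∀ {i j j₁ i₂ x y} → j + + 1 ≡ j₁ → j ≡ i₂ →
         a i j₁ ≡ x → a (i + + 1) i₂ ≡ y → b i j ≡ x * y
    at refl refl = cong₂ _*_

    b[i,i-3] : ∀ i → b i (i - + 3) ≡ 0ℤ
    b[i,i-3] i = trans (cong (λ j → a i j * a (i + + 1) (i - + 3)) (e i))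
                       (cong (_* a (i + + 1) (i - + 3)) ([i,i-2] i))
      where
      e : ∀ i → (i - + 3) + + 1 ≡ i - + 2
      e = solve-∀

    b[i,i-2] : ∀ i → b i (i - + 2) ≡ -1ℤ
    b[i,i-2] i = at (e i) (e′ i) ([i,i-1] i) ([i,i-3] (i + + 1))
      where
      e : ∀ i → (i - + 2) + + 1 ≡ i - + 1
      e = solve-∀
      e′ : ∀ i → i - + 2 ≡ (i + + 1) - + 3
      e′ = solve-∀

    b[i,i-1] : ∀ i → b i (i - + 1) ≡ 0ℤ
    b[i,i-1] i = trans (at refl (e i) refl ([i,i-2] (i + + 1)))
                       (*-zeroʳ (a i (i - + 1 + + 1)))
      where
      e : ∀ i → i - + 1 ≡ (i + + 1) - + 2
      e = solve-∀

    b[i,i+w] : ∀ i → b i (i + w) ≡ 0ℤ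
    b[i,i+w] i = cong (_* a (i + + 1) (i + w)) ([i,i+w+1] i)

    b[i,i+w+1] : ∀ i → b i (i + w + + 1) ≡ -1ℤ
    b[i,i+w+1] i = at (e i w) (e′ i w) ([i,i+w+2] i) ([i,i+w] (i + + 1))
      where
      e : ∀ i w → (i + w + + 1) + + 1 ≡ i + w + + 2
      e = solve-∀
      e′ : ∀ i w → i + w + + 1 ≡ (i + + 1) + w
      e′ = solve-∀

    b[i,i+w+2] : ∀ i → b i (i + w + + 2) ≡ 0ℤ
    b[i,i+w+2] i = trans (at refl (e i w) refl ([i,i+w+1] (i + + 1)))
                         (*-zeroʳ (a i (i + w + + 2 + + 1)))
      where
      e : ∀ i w → i + w + + 2 ≡ (i + + 1) + w + + 1
      e = solve-∀

    b-pos : ∀ i j → 0ℤ ≤ j - i → j - i ≤ w - + 1 → 0ℤ < b i j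
    b-pos i j lo hi = *-pos
      (positive′ i (j + + 1) (lin 2 lo (e₁ i j)) (lin 0 hi (e₂ i j w)))
      (positive′ (i + + 1) j (lin 0 lo (e₃ i j)) (lin 2 hi (e₄ i j w)))
      where
      e₁ : ∀ i j → ((j + + 1) - i) - (- + 1) ≡ ((j - i) - 0ℤ) + + 2
      e₁ = solve-∀
      e₂ : ∀ i j w → w - ((j + + 1) - i) ≡ ((w - + 1) - (j - i)) + + 0
      e₂ = solve-∀
      e₃ : ∀ i j → (j - (i + + 1)) - (- + 1) ≡ ((j - i) - 0ℤ) + + 0
      e₃ = solve-∀
      e₄ : ∀ i j w → w - (j - (i + + 1)) ≡ ((w - + 1) - (j - i)) + + 2
      e₄ = solve-∀

    b-diamond : ∀ i j → - + 2 ≤ j - i → j - i ≤ w + + 1 →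
                b i j * b (i + + 1) (j + + 1) ≡
                (1ℤ + b i (j + + 1)) * (1ℤ + b (i + + 1) j)
    b-diamond i j lo hi with j - i ≟ - + 2
    ... | yes e rewrite offset {i} {j} e = trans
            (cong₂ _*_ (b[i,i-2] i)
              (trans (cong (b (i + + 1)) (e₁ i)) (b[i,i-2] (i + + 1))))
            (sym (cong₂ (λ x y → (1ℤ + x) * (1ℤ + y))
              (trans (cong (b i) (e₂ i)) (b[i,i-1] i))
              (trans (cong (b (i + + 1)) (e₃ i)) (b[i,i-3] (i + + 1)))))
      where
      e₁ : ∀ i → (i - + 2) + + 1 ≡ (i + + 1) - + 2
      e₁ = solve-∀
      e₂ : ∀ i → (i - + 2) + + 1 ≡ i - + 1
      e₂ = solve-∀
      e₃ : ∀ i → i - + 2 ≡ (i + + 1) - + 3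
      e₃ = solve-∀
    ... | no ≢-2 with j - i ≟ w + + 1
    ... | yes e rewrite trans (offset {i} {j} e) (sym (+-assoc i w (+ 1))) = trans
            (cong₂ _*_ (b[i,i+w+1] i)
              (trans (cong (b (i + + 1)) (e₁ i w)) (b[i,i+w+1] (i + + 1))))
            (sym (cong₂ (λ x y → (1ℤ + x) * (1ℤ + y))
              (trans (cong (b i) (e₂ i w)) (b[i,i+w+2] i))
              (trans (cong (b (i + + 1)) (e₃ i w)) (b[i,i+w] (i + + 1)))))
      where
      e₁ : ∀ i w → (i + w + + 1) + + 1 ≡ (i + + 1) + w + + 1
      e₁ = solve-∀
      e₂ : ∀ i w → (i + w + + 1) + + 1 ≡ i + w + + 2
      e₂ = solve-∀
      e₃ : ∀ i w → i + w + + 1 ≡ (i + + 1) + w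
      e₃ = solve-∀
    ... | no ≢w+1 = trans
            (rearrange (a i (j + + 1)) (a (i + + 1) j)
                       (a (i + + 1) (j + + 1 + + 1)) (a (i + + 1 + + 1) (j + + 1)))
            (cong₂ _*_
              (diamond i (j + + 1) (lin 1 lo (e₁ i j))
                (lin 0 (strict hi (λ e → ≢w+1 (sym e))) (e₂ i j w)))
              (diamond (i + + 1) j (lin 0 (strict lo ≢-2) (e₃ i j))
                (lin 1 hi (e₄ i j w))))
      where
      rearrange : ∀ p q r s → (p * q) * (r * s) ≡ (p * r) * (q * s)
      rearrange = solve-∀
      e₁ : ∀ i j → ((j + + 1) - i) - (- + 2) ≡ ((j - i) - (- + 2)) + + 1
      e₁ = solve-∀
      e₂ : ∀ i j w → (w + + 1) - ((j + + 1) - i) ≡ ((w + + 1) - ((j - i) + + 1)) + + 0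
      e₂ = solve-∀
      e₃ : ∀ i j → (j - (i + + 1)) - (- + 2) ≡ ((j - i) - (- + 2 + + 1)) + + 0
      e₃ = solve-∀
      e₄ : ∀ i j w → (w + + 1) - (j - (i + + 1)) ≡ ((w + + 1) - (j - i)) + + 1
      e₄ = solve-∀

    image : YFrieze w
    image = b , record
      { [i,i-3] = b[i,i-3] ; [i,i-2] = b[i,i-2] ; [i,i-1] = b[i,i-1]
      ; [i,i+w] = b[i,i+w] ; [i,i+w+1] = b[i,i+w+1] ; [i,i+w+2] = b[i,i+w+2]
      ; pos = b-pos ; diamond = b-diamond }

    isImage : A MapsTo image
    isImage i = trans (at refl (e i) refl ([i,i-1] (i + + 1))) (*-identityʳ _)
      where
      e : ∀ i → i ≡ (i + + 1) - + 1
      e = solve-∀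

  nonNeg : ∀ {w} (B : YFrieze w) → let open YFrieze B in
           ∀ i j → - + 1 ≤ j - i → j - i ≤ w → 0ℤ ≤ entry i j
  nonNeg {w} B i j lo hi with j - i ≟ - + 1
  ... | yes e = ≤-reflexive
                  (sym (trans (cong (entry i) (offset e)) ([i,i-1] i)))
    where open YFrieze B
  ... | no ≢-1 with j - i ≟ w
  ... | yes e = ≤-reflexive
                  (sym (trans (cong (entry i) (offset e)) ([i,i+w] i)))
    where open YFrieze B
  ... | no ≢w = <⇒≤ (pos i j (strict lo ≢-1)
                  (lin 0 (strict hi (λ e → ≢w (sym e))) (arith w (j - i))))
    where
    open YFrieze B
    arith : ∀ w d → (w - + 1) - d ≡ (w - (d + + 1)) + + 0
    arith = solve-∀

  module Uniqueness {w} (B C : YFrieze w) where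
    open YFrieze B renaming (entry to b)
    module C = YFrieze C
    open C using () renaming (entry to c)

    AgreeAt : ℕ → Set
    AgreeAt n = ∀ i j → j - i ≡ - + 1 + + n → j - i ≤ w + + 2 → b i j ≡ c i j

    next : ∀ n → AgreeAt n → AgreeAt (suc n) → AgreeAt (suc (suc n))
    next n agree₀ agree₁ i j e hi =
      subst (λ j → b i j ≡ c i j) (j-1+1 j) (∙-cancelˡ 1ℤ _ _ step)
      where
      j′ = j - + 1

      j-1+1 : ∀ j → (j - + 1) + + 1 ≡ j
      j-1+1 = solve-∀

      e′ : j′ - i ≡ - + 1 + + (suc n)
      e′ = trans (f i j) (trans (cong (_- + 1) e) (g (+ n)))
        where
        f : ∀ i j → (j - + 1) - i ≡ (j - i) - + 1
        f = solve-∀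
        g : ∀ n → (- + 1 + (+ 2 + n)) - + 1 ≡ - + 1 + (+ 1 + n)
        g = solve-∀

      e″ : j′ - (i + + 1) ≡ - + 1 + + n
      e″ = trans (f i j) (trans (cong (_- + 2) e) (g (+ n)))
        where
        f : ∀ i j → (j - + 1) - (i + + 1) ≡ (j - i) - + 2
        f = solve-∀
        g : ∀ n → (- + 1 + (+ 2 + n)) - + 2 ≡ - + 1 + n
        g = solve-∀

      e‴ : (j′ + + 1) - (i + + 1) ≡ - + 1 + + (suc n)
      e‴ = trans (f i j) e′
        where
        f : ∀ i j → ((j - + 1) + + 1) - (i + + 1) ≡ (j - + 1) - i
        f = solve-∀

      hi′ : j′ - i ≤ w + + 1
      hi′ = lin 0 hi (f i j w)
        where
        f : ∀ i j w → (w + + 1) - ((j - + 1) - i) ≡ ((w + + 2) - (j - i)) + + 0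
        f = solve-∀

      hi″ : j′ - (i + + 1) ≤ w
      hi″ = lin 0 hi (f i j w)
        where
        f : ∀ i j w → w - ((j - + 1) - (i + + 1)) ≡ ((w + + 2) - (j - i)) + + 0
        f = solve-∀

      ≥-1 : ∀ {d} m → d ≡ - + 1 + + m → - + 1 ≤ d
      ≥-1 m refl = i≤i+j (- + 1) (+ m)

      lo′ : - + 2 ≤ j′ - i
      lo′ = lin 1 (≥-1 (suc n) e′) (f (j′ - i))
        where
        f : ∀ d → d - (- + 2) ≡ (d - (- + 1)) + + 1
        f = solve-∀

      ih′ : b i j′ ≡ c i j′
      ih′ = agree₁ i j′ e′ (lin 1 hi′ (f w (j′ - i)))
        where
        f : ∀ w d → (w + + 2) - d ≡ ((w + + 1) - d) + + 1
        f = solve-∀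

      ih″ : b (i + + 1) j′ ≡ c (i + + 1) j′
      ih″ = agree₀ (i + + 1) j′ e″ (lin 2 hi″ (f w (j′ - (i + + 1))))
        where
        f : ∀ w d → (w + + 2) - d ≡ (w - d) + + 2
        f = solve-∀

      ih‴ : b (i + + 1) (j′ + + 1) ≡ c (i + + 1) (j′ + + 1)
      ih‴ = agree₁ (i + + 1) (j′ + + 1) e‴
              (lin 1 hi′ (f i j′ w))
        where
        f : ∀ i j w → (w + + 2) - ((j + + 1) - (i + + 1)) ≡ ((w + + 1) - (j - i)) + + 1
        f = solve-∀

      instance
        nz : NonZero (1ℤ + b (i + + 1) j′)
        nz = >-nonZero (<-≤-trans 0<1
               (+-monoʳ-≤ 1ℤ (nonNeg B (i + + 1) j′ (≥-1 n e″) hi″)))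

      step : 1ℤ + b i (j′ + + 1) ≡ 1ℤ + c i (j′ + + 1)
      step = *-cancelʳ-≡ _ _ (1ℤ + b (i + + 1) j′) (begin
        (1ℤ + b i (j′ + + 1)) * (1ℤ + b (i + + 1) j′)  ≡⟨ diamond i j′ lo′ hi′ ⟨
        b i j′ * b (i + + 1) (j′ + + 1)                ≡⟨ cong₂ _*_ ih′ ih‴ ⟩
        c i j′ * c (i + + 1) (j′ + + 1)                ≡⟨ C.diamond i j′ lo′ hi′ ⟩
        (1ℤ + c i (j′ + + 1)) * (1ℤ + c (i + + 1) j′)  ≡⟨ cong (λ x → (1ℤ + c i (j′ + + 1)) * (1ℤ + x)) ih″ ⟨
        (1ℤ + c i (j′ + + 1)) * (1ℤ + b (i + + 1) j′)  ∎)
        where open ≡-Reasoning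

    module _ (diag : ∀ i → b i i ≡ c i i) where

      agree : ∀ n → AgreeAt n
      agree 0 i j e _ rewrite offset {i} {j} e = trans ([i,i-1] i) (sym (C.[i,i-1] i))
      agree 1 i j e _ rewrite offset {i} {j} e | +-identityʳ i = diag i
      agree (suc (suc n)) = next n (agree n) (agree (suc n))

      unique : B ≈Y C
      unique i j (lo , hi) with j - i ≟ - + 3
      ... | yes e rewrite offset {i} {j} e = trans ([i,i-3] i) (sym (C.[i,i-3] i))
      ... | no ≢-3 with j - i ≟ - + 2
      ... | yes e rewrite offset {i} {j} e = trans ([i,i-2] i) (sym (C.[i,i-2] i))
      ... | no ≢-2 = agree ∣ j - i + + 1 ∣ i j eq hi
        where
        0≤ : 0ℤ ≤ j - i + + 1
        0≤ = lin 0 (strict (strict lo ≢-3) ≢-2) (f (j - i))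
          where
          f : ∀ d → (d + + 1) - 0ℤ ≡ (d - (- + 3 + + 1 + + 1)) + + 0
          f = solve-∀
        eq : j - i ≡ - + 1 + + ∣ j - i + + 1 ∣
        eq = trans (f (j - i)) (cong (λ x → - + 1 + x) (sym (0≤i⇒+∣i∣≡i 0≤)))
          where
          f : ∀ d → d ≡ - + 1 + (d + + 1)
          f = solve-∀

-- The witness is b_{i,j} = a_{i,j+1} a_{i+1,j}.
∃!-image : ∀ {w} (A : Frieze w) → ∃! _≈Y_ (A MapsTo_)
∃!-image A = image , isImage ,
  λ {C} C-image → Uniqueness.unique image C
                    (λ i → trans (isImage i) (sym (C-image i)))
  where open FriezeLemmas A

p : ∀ {w} → Frieze w → YFrieze w
p A = proj₁ (∃!-image A)

p-cong : ∀ {w} → -1ℤ ≤ w → (A A′ : Frieze w) → A ≈F A′ → p A ≈Y p A′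
p-cong {w} -1≤w A A′ A≈A′ = Uniqueness.unique (p A) (p A′) λ i →
  trans (mapsTo A i) (trans (A≈A′ i (i + + 1) (strip i)) (sym (mapsTo A′ i)))
  where
  mapsTo : (A : Frieze w) → A MapsTo p A
  mapsTo A = proj₁ (proj₂ (∃!-image A))
  strip : ∀ i → InStrip w i (i + + 1)
  strip i = lin 0 (i≤i+j (- + 3) (+ 4)) (lo i) , lin 0 -1≤w (hi i w)
    where
    lo : ∀ i → ((i + + 1) - i) - (- + 3) ≡ ((- + 3 + + 4) - (- + 3)) + + 0
    lo = solve-∀
    hi : ∀ i w → (w + + 2) - ((i + + 1) - i) ≡ (w - (- + 1)) + + 0
    hi = solve-∀

{-# OPTIONS --safe #-}
module Submission where

-- It suffices to find positive integers c_i with c_i c_{i+1} = 1 + b_{i,i} for all i: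
-- the continuants of c then satisfy b_{i,j} = a_{i,j+1} a_{i+1,j} and
-- 1 + b_{i,j} = a_{i,j} a_{i+1,j+1}, so b_{i,i+w} = 0 makes a_{i,i+w} a positive divisor of 1
-- and closes the frieze.
--
-- On an interval of w + 2 indices, c is found by extending to the left one index at a time.
-- The new value m/d, where m = 1 + b_{i,i} and d is the current leftmost entry, need not be
-- an integer, but c may be rescaled, alternate entries by λ and 1/λ.
-- Integrality of the b_{i,j} forces m/d times every entry at even distance from d to be an
-- integer, so these entries are divisible by the reduced denominator λ of m/d.
-- Beyond w + 2 indices the next value is itself a continuant, hence an integer, and the
-- resulting sequence is periodic with period w + 3, hence so are the b_{i,i}, and the sequence
-- extends to the right.

open import Defs
open import Data.Integer
  using (ℤ; +_; -[1+_]; 0ℤ; 1ℤ; -1ℤ; _+_; _-_; _*_; -_; ∣_∣; _≤_; _<_;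
         +<+; +≤+; -≤+; -≤-; >-nonZero; positive; nonNegative)
open import Data.Integer.Properties
open import Data.Integer.Coprimality using (Coprime; coprime-divisor)
open import Data.Integer.Divisibility.Signed
open _∣_ using (quotient; equality)
open import Algebra.Properties.AbelianGroup +-0-abelianGroup
  using () renaming (∙-cancelˡ to +-cancelˡ)
open import Data.Integer.Tactic.RingSolver using (solve-∀)
open import Data.Nat.Base as ℕ using (ℕ; zero; suc; z≤n; s≤s)
import Data.Nat.Coprimality as ℕ using (GCD≡1⇒coprime)
import Data.Nat.Divisibility as ℕ using (divides)
import Data.Nat.GCD as ℕ using (module GCD; mkGCD; GCD-*)
import Data.Nat.Properties as ℕ
import Data.Nat.Tactic.RingSolver as ℕ-Solver
open import Data.Product using (_,_; proj₁; proj₂; _×_; ∃)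
open import Data.Sum.Base using (_⊎_; inj₁; inj₂)
open import Function.Base using (_∘_)
open import Function.Definitions using (StrictlySurjective)
open import Relation.Binary.PropositionalEquality
open import Relation.Nullary using (contradiction)

-- Positive integers and reduced fractions

0<1 : 0ℤ < 1ℤ
0<1 = +<+ (s≤s z≤n)

*-pos : ∀ {x y} → 0ℤ < x → 0ℤ < y → 0ℤ < x * y
*-pos {x} {y} 0<x 0<y =
  subst (_< x * y) (*-zeroʳ x) (*-monoˡ-<-pos x ⦃ positive 0<x ⦄ 0<y)

*-pos-cancelʳ : ∀ {x y} → 0ℤ < x * y → 0ℤ < y → 0ℤ < x
*-pos-cancelʳ {x} {y} 0<xy 0<y =
  *-cancelʳ-<-nonNeg y ⦃ nonNegative (<⇒≤ 0<y) ⦄ 0<xy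

*-cancelʳ : ∀ {x y z} → 0ℤ < z → x * z ≡ y * z → x ≡ y
*-cancelʳ {x} {y} {z} 0<z = *-cancelʳ-≡ x y z ⦃ >-nonZero 0<z ⦄

*-cancelˡ : ∀ {x y z} → 0ℤ < z → z * x ≡ z * y → x ≡ y
*-cancelˡ {x} {y} {z} 0<z = *-cancelˡ-≡ z x y ⦃ >-nonZero 0<z ⦄

*≡1⇒≡1 : ∀ {x y} → 0ℤ < x → x * y ≡ 1ℤ → x ≡ 1ℤ
*≡1⇒≡1 {x} {y} 0<x xy≡1 = trans (sym (0≤i⇒+∣i∣≡i (<⇒≤ 0<x)))
  (cong +_ (ℕ.m*n≡1⇒m≡1 ∣ x ∣ ∣ y ∣ (trans (sym (abs-* x y)) (cong ∣_∣ xy≡1))))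

lowestTerms : ∀ {x y} → 0ℤ < x → 0ℤ < y → ∃ λ g → ∃ λ x′ → ∃ λ y′ →
              0ℤ < g × x ≡ x′ * g × y ≡ y′ * g × Coprime x′ y′
lowestTerms {+ suc m} {+ suc n} _ _ with ℕ.mkGCD (suc m) (suc n)
... | zero , G with ℕ.GCD.gcd∣m G
...   | ℕ.divides q eq = contradiction (trans eq (ℕ.*-zeroʳ q)) λ ()
lowestTerms {+ suc m} {+ suc n} _ _ | suc g , G
  with ℕ.GCD.gcd∣m G | ℕ.GCD.gcd∣n G
... | ℕ.divides q eq | ℕ.divides r eq′ =
  + suc g , + q , + r , +<+ (s≤s z≤n) ,
  trans (cong +_ eq) (pos-* q (suc g)) , trans (cong +_ eq′) (pos-* r (suc g)) ,
  ℕ.GCD≡1⇒coprime (ℕ.GCD-* {c = suc g}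
    (subst₂ (λ a b → ℕ.GCD.GCD a b (1 ℕ.* suc g)) eq eq′ (subst (ℕ.GCD.GCD _ _) (sym (ℕ.*-identityˡ (suc g))) G)))
lowestTerms {+ zero} (+<+ ()) _
lowestTerms {+ suc _} {+ zero} _ (+<+ ())

-- Streams and finite choice

Stream : Set
Stream = ℕ → ℤ

tail : Stream → Stream
tail d = d ∘ suc

infixr 5 _∷_
_∷_ : ℤ → Stream → Stream
(x ∷ d) zero    = x
(x ∷ d) (suc k) = d k

parity : ∀ k → (∃ λ j → k ≡ j ℕ.* 2) ⊎ (∃ λ j → k ≡ 1 ℕ.+ j ℕ.* 2)
parity zero = inj₁ (0 , refl)
parity (suc k) with parity k
... | inj₁ (j , refl) = inj₂ (j , refl)
... | inj₂ (j , refl) = inj₁ (suc j , refl)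

-- Collects finitely many existence statements into one total stream; the values from L on default
-- to 0.
choice : ∀ {Q : ℕ → ℤ → Set} L → (∀ k → k ℕ.< L → ∃ (Q k)) →
         ∃ λ (f : Stream) → ∀ {k} → k ℕ.< L → Q k (f k)
choice zero    _ = (λ _ → 0ℤ) , λ ()
choice (suc L) h with h 0 (s≤s z≤n) | choice L (λ k k< → h (suc k) (s≤s k<))
... | x , q | f , qs = x ∷ f , λ { {zero} _ → q ; {suc k} (s≤s k<) → qs k< }

-- Continuants

-- If d lists the entries c_i, c_{i+1}, … then K d k = a_{i,i+k-2}.
K : Stream → ℕ → ℤ
K d 0             = 0ℤ
K d 1             = 1ℤ
K d (suc (suc k)) = K d (suc k) * d k - K d k

K-cong : ∀ {d d′} → (∀ k → d k ≡ d′ k) → ∀ k → K d k ≡ K d′ k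
K-cong eq 0 = refl
K-cong eq 1 = refl
K-cong eq (suc (suc k)) =
  cong₂ _-_ (cong₂ _*_ (K-cong eq (suc k)) (eq k)) (K-cong eq k)

-- The recursion defining `K` works at the right end; continuants are symmetric and satisfy the same
-- recursion at the left end.
K-tail : ∀ d k → K d (2 ℕ.+ k) ≡ d 0 * K (tail d) (1 ℕ.+ k) - K (tail (tail d)) k
K-tail d 0 = eq (d 0)
  where
  eq : ∀ x → 1ℤ * x - 0ℤ ≡ x * 1ℤ - 0ℤ
  eq = solve-∀
K-tail d 1 = eq (d 0) (d 1)
  where
  eq : ∀ x y → (1ℤ * x - 0ℤ) * y - 1ℤ ≡ x * (1ℤ * y - 0ℤ) - 1ℤ
  eq = solve-∀
K-tail d (suc (suc k)) = trans
  (cong₂ (λ p q → p * d (2 ℕ.+ k) - q) (K-tail d (suc k)) (K-tail d k))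
  (eq (d 0) (d (2 ℕ.+ k)) (K (tail d) (2 ℕ.+ k)) (K (tail d) (1 ℕ.+ k))
      (K (tail (tail d)) (1 ℕ.+ k)) (K (tail (tail d)) k))
  where
  eq : ∀ x z p q r s → (x * p - r) * z - (x * q - s) ≡ x * (p * z - q) - (r * z - s)
  eq = solve-∀

-- This is the determinant 1 of a product of matrices with rows (x, -1) and (1, 0); each step of the
-- recursion preserves it.
K-diamond : ∀ d k → K d (1 ℕ.+ k) * K (tail d) (1 ℕ.+ k) ≡
                    1ℤ + K d (2 ℕ.+ k) * K (tail d) k
K-diamond d 0 = eq (K d 2)
  where
  eq : ∀ x → 1ℤ * 1ℤ ≡ 1ℤ + x * 0ℤ
  eq = solve-∀
K-diamond d (suc k) =
  step (K d (2 ℕ.+ k)) (K d (1 ℕ.+ k)) (K (tail d) (1 ℕ.+ k)) (K (tail d) k)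
       (d (1 ℕ.+ k)) (K-diamond d k)
  where
  step : ∀ p q r s z → q * r ≡ 1ℤ + p * s → p * (r * z - s) ≡ 1ℤ + (p * z - q) * r
  step p q r s z eq = trans (e₁ p r s z) (trans (cong (λ t → p * z * r - t)
    (trans (e₂ (p * s)) (cong (_- 1ℤ) (sym eq)))) (e₃ p q r z))
    where
    e₁ : ∀ p r s z → p * (r * z - s) ≡ p * z * r - p * s
    e₁ = solve-∀
    e₂ : ∀ t → t ≡ (1ℤ + t) - 1ℤ
    e₂ = solve-∀
    e₃ : ∀ p q r z → p * z * r - (q * r - 1ℤ) ≡ 1ℤ + (p * z - q) * r
    e₃ = solve-∀

-- Continuants with a prospective left entry

-- If d continues to the left by x with x * d 0 = m, then
-- K⁺ m d k = d 0 * K (x ∷ d) k, which makes sense without x.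
K⁺ : ℤ → Stream → ℕ → ℤ
K⁺ m d 0             = 0ℤ
K⁺ m d 1             = d 0
K⁺ m d (suc (suc k)) = m * K d (suc k) - d 0 * K (tail d) k

-- Here the prospective left entry of `tail d` exists and is `d 0`, so the claim is `K-tail`
-- multiplied by `d 1`.
K⁺-tail : ∀ {m} d → d 0 * d 1 ≡ m → ∀ k → K⁺ m (tail d) k ≡ d 1 * K d k
K⁺-tail d refl 0 = sym (*-zeroʳ (d 1))
K⁺-tail d refl 1 = sym (*-identityʳ (d 1))
K⁺-tail d refl (suc (suc k)) = trans
  (eq (d 0) (d 1) (K (tail d) (suc k)) (K (tail (tail d)) k))
  (cong (d 1 *_) (sym (K-tail d k)))
  where
  eq : ∀ x y p q → x * y * p - y * q ≡ y * (x * p - q)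
  eq = solve-∀

-- The diamond rule of `x ∷ d` multiplied by `d 0`.
K⁺-diamond : ∀ m d k → K⁺ m d (1 ℕ.+ k) * K d (1 ℕ.+ k) ≡
                       d 0 + K⁺ m d (2 ℕ.+ k) * K d k
K⁺-diamond m d 0 = eq (d 0) (K⁺ m d 2)
  where
  eq : ∀ x y → x * 1ℤ ≡ x + y * 0ℤ
  eq = solve-∀
K⁺-diamond m d (suc k) = begin
  (m * f₁ - x * g₀) * f₂              ≡⟨ e₁ m x f₁ f₂ g₀ ⟩
  m * f₁ * f₂ + x - x * (1ℤ + f₂ * g₀) ≡⟨ cong (λ t → m * f₁ * f₂ + x - x * t) (K-diamond d k) ⟨
  m * f₁ * f₂ + x - x * (f₁ * g₁)     ≡⟨ e₂ m x f₁ f₂ g₁ ⟩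
  x + (m * f₂ - x * g₁) * f₁          ∎
  where
  open ≡-Reasoning
  x = d 0
  f₁ = K d (1 ℕ.+ k)
  f₂ = K d (2 ℕ.+ k)
  g₀ = K (tail d) k
  g₁ = K (tail d) (1 ℕ.+ k)
  e₁ : ∀ m x f₁ f₂ g₀ → (m * f₁ - x * g₀) * f₂ ≡ m * f₁ * f₂ + x - x * (1ℤ + f₂ * g₀)
  e₁ = solve-∀
  e₂ : ∀ m x f₁ f₂ g₁ → m * f₁ * f₂ + x - x * (f₁ * g₁) ≡ x + (m * f₂ - x * g₁) * f₁
  e₂ = solve-∀

-- Strips of Y-friezes and windows of candidates for c

-- The entry y s k stands for b_{s,s+k-1}.
record YStrip (w : ℕ) (y : ℤ → ℕ → ℤ) : Set where
  field
    zeroˡ   : ∀ s → y s 0 ≡ 0ℤ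
    zeroʳ   : ∀ s → y s (1 ℕ.+ w) ≡ 0ℤ
    pos     : ∀ s {k} → k ℕ.< w → 0ℤ < y s (1 ℕ.+ k)
    diamond : ∀ s {k} → k ℕ.< w →
              y s (1 ℕ.+ k) * y (s + + 1) (1 ℕ.+ k) ≡
              (1ℤ + y s (2 ℕ.+ k)) * (1ℤ + y (s + + 1) k)

module Strip {w y} (Y : YStrip w y) where
  open YStrip Y

  0≤y : ∀ s {k} → k ℕ.≤ 1 ℕ.+ w → 0ℤ ≤ y s k
  0≤y s {zero} _ = ≤-reflexive (sym (zeroˡ s))
  0≤y s {suc k} (s≤s k≤w) with ℕ.m≤n⇒m<n∨m≡n k≤w
  ... | inj₁ k<w  = <⇒≤ (pos s k<w)
  ... | inj₂ refl = ≤-reflexive (sym (zeroʳ s))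

  0<1+y : ∀ s {k} → k ℕ.≤ 1 ℕ.+ w → 0ℤ < 1ℤ + y s k
  0<1+y s k≤ = <-≤-trans 0<1 (+-monoʳ-≤ 1ℤ (0≤y s k≤))

  m : ℤ → ℤ
  m s = 1ℤ + y s 1

  -- The first L values of `d` are candidates for c_s, ..., c_{s+L-1}; only these are constrained.
  record Window (s : ℤ) (L : ℕ) (d : Stream) : Set where
    field
      positive′ : ∀ {k} → k ℕ.< L → 0ℤ < d k
      product   : ∀ {k} → suc k ℕ.< L → d k * d (suc k) ≡ m (s + + k)
  open Window public

  +-suc-assoc : ∀ s k → s + + 1 + + k ≡ s + + suc k
  +-suc-assoc s k = +-assoc s (+ 1) (+ k)

  truncate : ∀ {s L L′ d} → L′ ℕ.≤ L → Window s L d → Window s L′ d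
  truncate L′≤L W = record
    { positive′ = λ k< → positive′ W (ℕ.<-≤-trans k< L′≤L)
    ; product   = λ k< → product W (ℕ.<-≤-trans k< L′≤L) }

  tailWindow : ∀ {s L d} → Window s (suc L) d → Window (s + + 1) L (tail d)
  tailWindow {s} W = record
    { positive′ = λ k< → positive′ W (s≤s k<)
    ; product   = λ {k} k< → trans (product W (s≤s k<)) (cong m (sym (+-suc-assoc s k))) }

  consWindow : ∀ {s L d x} → 0ℤ < x → x * d 0 ≡ m s →
               Window (s + + 1) L d → Window s (suc L) (x ∷ d)
  consWindow {s} {L} {d} {x} 0<x xd₀ W = record
    { positive′ = λ { {zero} _ → 0<x ; {suc k} (s≤s k<) → positive′ W k< }
    ; product   = λ { {zero} _ → trans xd₀ (cong m (sym (+-identityʳ s)))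
                    ; {suc k} (s≤s k<) → trans (product W k<) (cong m (+-suc-assoc s k)) } }

  firstProduct : ∀ {s L d} → 2 ℕ.≤ L → Window s L d → d 0 * d 1 ≡ m s
  firstProduct {s} 2≤L W = trans (product W 2≤L) (cong m (+-identityʳ s))

  -- Factorisation of Y-frieze entries into continuants

  mutual
    -- The four identities go by one induction on k: the Y-diamond rule determines `y s (2 + k)`
    -- from entries with smaller k, whose factorisations are already known. The versions with `K⁺`
    -- use candidates from s + 1 on only, so they describe row s before an entry at s has been
    -- found.
    relation⁺ : ∀ {s d} k → k ℕ.≤ 1 ℕ.+ w → Window (s + + 1) k d →
                d 0 * (1ℤ + y s k) ≡ K⁺ (m s) d (1 ℕ.+ k) * K d (1 ℕ.+ k)
    relation⁺ {s} {d} 0 _ _ rewrite zeroˡ s = refl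
    relation⁺ {s} {d} 1 _ _ = eq (d 0) (m s)
      where
      eq : ∀ x m → x * m ≡ (m * 1ℤ - x * 0ℤ) * (1ℤ * x - 0ℤ)
      eq = solve-∀
    relation⁺ {s} {d} (suc (suc k)) 2+k≤@(s≤s k<w) W =
      *-cancelʳ {z = 1ℤ + y′ k} (0<1+y (s + + 1) k≤) (begin
        d 0 * (1ℤ + y s (2 ℕ.+ k)) * (1ℤ + y′ k)
          ≡⟨ *-assoc (d 0) _ _ ⟩
        d 0 * ((1ℤ + y s (2 ℕ.+ k)) * (1ℤ + y′ k))
          ≡⟨ cong (d 0 *_) (diamond s k<w) ⟨
        d 0 * (y s (1 ℕ.+ k) * y′ (1 ℕ.+ k))
          ≡⟨ *-assoc (d 0) _ _ ⟨
        d 0 * y s (1 ℕ.+ k) * y′ (1 ℕ.+ k)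
          ≡⟨ cong₂ _*_ (entry⁺ (suc k) 1+k≤ (truncate (ℕ.n≤1+n _) W))
                       (entry (suc k) 1+k≤ W) ⟩
        K⁺ (m s) d (3 ℕ.+ k) * K d (1 ℕ.+ k) * (K d (3 ℕ.+ k) * K (tail d) (1 ℕ.+ k))
          ≡⟨ swap (K⁺ (m s) d (3 ℕ.+ k)) (K d (1 ℕ.+ k)) (K d (3 ℕ.+ k)) (K (tail d) (1 ℕ.+ k)) ⟩
        K⁺ (m s) d (3 ℕ.+ k) * K d (3 ℕ.+ k) * (K d (1 ℕ.+ k) * K (tail d) (1 ℕ.+ k))
          ≡⟨ cong (K⁺ (m s) d (3 ℕ.+ k) * K d (3 ℕ.+ k) *_)
                  (relation k k≤ (truncate (ℕ.n≤1+n _) W)) ⟨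
        K⁺ (m s) d (3 ℕ.+ k) * K d (3 ℕ.+ k) * (1ℤ + y′ k) ∎)
      where
      open ≡-Reasoning
      y′ = y (s + + 1)
      1+k≤ = ℕ.≤-trans (ℕ.n≤1+n _) 2+k≤
      k≤ = ℕ.≤-trans (ℕ.n≤1+n _) 1+k≤
      swap : ∀ p q r t → p * q * (r * t) ≡ p * r * (q * t)
      swap = solve-∀

    entry⁺ : ∀ {s d} k → k ℕ.≤ 1 ℕ.+ w → Window (s + + 1) k d →
             d 0 * y s k ≡ K⁺ (m s) d (2 ℕ.+ k) * K d k
    entry⁺ {s} {d} k k≤ W = +-cancelˡ (d 0) _ _ (begin
      d 0 + d 0 * y s k                        ≡⟨ distrib (d 0) (y s k) ⟩
      d 0 * (1ℤ + y s k)                       ≡⟨ relation⁺ k k≤ W ⟩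
      K⁺ (m s) d (1 ℕ.+ k) * K d (1 ℕ.+ k)     ≡⟨ K⁺-diamond (m s) d k ⟩
      d 0 + K⁺ (m s) d (2 ℕ.+ k) * K d k       ∎)
      where
      open ≡-Reasoning
      distrib : ∀ x y → x + x * y ≡ x * (1ℤ + y)
      distrib = solve-∀

    -- Once the entry at s exists, `K⁺-tail` turns `relation⁺` for `tail d` into this identity times
    -- `d 1`.
    relation : ∀ {s d} k → k ℕ.≤ 1 ℕ.+ w → Window s (1 ℕ.+ k) d →
               1ℤ + y s k ≡ K d (1 ℕ.+ k) * K (tail d) (1 ℕ.+ k)
    relation {s} 0 _ _ rewrite zeroˡ s = refl
    relation {s} {d} (suc k) k≤ W = *-cancelˡ (positive′ W (s≤s (s≤s z≤n))) (begin
      d 1 * (1ℤ + y s (1 ℕ.+ k))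
        ≡⟨ relation⁺ (suc k) k≤ (tailWindow W) ⟩
      K⁺ (m s) (tail d) (2 ℕ.+ k) * K (tail d) (2 ℕ.+ k)
        ≡⟨ cong (_* K (tail d) (2 ℕ.+ k))
                (K⁺-tail d (firstProduct (s≤s (s≤s z≤n)) W) (2 ℕ.+ k)) ⟩
      d 1 * K d (2 ℕ.+ k) * K (tail d) (2 ℕ.+ k)
        ≡⟨ *-assoc (d 1) (K d (2 ℕ.+ k)) _ ⟩
      d 1 * (K d (2 ℕ.+ k) * K (tail d) (2 ℕ.+ k)) ∎)
      where open ≡-Reasoning

    entry : ∀ {s d} k → k ℕ.≤ 1 ℕ.+ w → Window s (1 ℕ.+ k) d →
            y s k ≡ K d (2 ℕ.+ k) * K (tail d) k
    entry {s} {d} k k≤ W =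
      +-cancelˡ 1ℤ _ _ (trans (relation k k≤ W) (K-diamond d k))

  -- By `entry`, a positive y is this continuant times one of smaller index, positive by induction.
  K-positive : ∀ {s d} k → k ℕ.≤ 1 ℕ.+ w → Window s k d → 0ℤ < K d (1 ℕ.+ k)
  K-positive 0 _ _ = 0<1
  K-positive {d = d} 1 _ W = subst (0ℤ <_) (eq (d 0)) (positive′ W (s≤s z≤n))
    where
    eq : ∀ x → x ≡ 1ℤ * x - 0ℤ
    eq = solve-∀
  K-positive {s} {d} (suc (suc k)) (s≤s k<w) W = *-pos-cancelʳ
    (subst (0ℤ <_) (entry (suc k) (ℕ.m≤n⇒m≤1+n k<w) W) (pos s k<w))
    (K-positive k (ℕ.<⇒≤ (ℕ.m≤n⇒m≤1+n k<w)) (truncate (ℕ.n≤1+n k) (tailWindow W)))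

  -- The closing border and sliding to the left

  module _ {s d} (W : Window s (2 ℕ.+ w) d) where

    K[2+w]≡1 : K d (2 ℕ.+ w) ≡ 1ℤ
    K[2+w]≡1 = *≡1⇒≡1 (K-positive (1 ℕ.+ w) ℕ.≤-refl (truncate (ℕ.n≤1+n _) W))
      (trans (sym (relation (1 ℕ.+ w) ℕ.≤-refl W)) (cong (λ t → 1ℤ + t) (zeroʳ s)))

    K-tail-positive : 0ℤ < K (tail d) (1 ℕ.+ w)
    K-tail-positive = K-positive w (ℕ.n≤1+n w) (truncate (ℕ.n≤1+n w) (tailWindow W))

    K[3+w]≡0 : K d (3 ℕ.+ w) ≡ 0ℤ
    K[3+w]≡0 = *-cancelʳ K-tail-positive
      (trans (sym (entry (1 ℕ.+ w) ℕ.≤-refl W)) (zeroʳ s))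

    -- Obtained by solving the recursion for `K d (3 + w)` with the two border values 1 and 0. The
    -- right-hand side is the entry that two slides later stands at index s - 2, which yields the
    -- period w + 3.
    lastEntry : d (1 ℕ.+ w) ≡ K d (1 ℕ.+ w)
    lastEntry = begin
      d (1 ℕ.+ w)                                  ≡⟨ eq (d (1 ℕ.+ w)) (K d (1 ℕ.+ w)) ⟩
      (1ℤ * d (1 ℕ.+ w) - K d (1 ℕ.+ w)) + K d (1 ℕ.+ w)
        ≡⟨ cong (λ t → (t * d (1 ℕ.+ w) - K d (1 ℕ.+ w)) + K d (1 ℕ.+ w)) K[2+w]≡1 ⟨
      K d (3 ℕ.+ w) + K d (1 ℕ.+ w)                ≡⟨ cong (_+ K d (1 ℕ.+ w)) K[3+w]≡0 ⟩
      0ℤ + K d (1 ℕ.+ w)                           ≡⟨ +-identityˡ _ ⟩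
      K d (1 ℕ.+ w)                                ∎
      where
      open ≡-Reasoning
      eq : ∀ x z → x ≡ (1ℤ * x - z) + z
      eq = solve-∀

  -- The glide symmetry of friezes of width w gives c_{-1} = a_{-1,-1} = a_{1,w}.
  slide : Stream → Stream
  slide d = K (tail d) (1 ℕ.+ w) ∷ d

  -- The zero border of row s makes `K⁺ (m s) d (3 + w)` vanish. Expanded with `K d (2 + w)` equal
  -- to 1, this says that the new entry times `d 0` is `m s`.
  slideWindow : ∀ {s d} → Window (s + + 1) (2 ℕ.+ w) d → Window s (2 ℕ.+ w) (slide d)
  slideWindow {s} {d} W =
    -- The rightmost entry is dropped, so the length stays w + 2 and the slide can be repeated.
    truncate (ℕ.n≤1+n _) (consWindow (K-tail-positive W) (sym m≡) W)
    where
    W′ : Window (s + + 1) (1 ℕ.+ w) d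
    W′ = truncate (ℕ.n≤1+n _) W
    K⁺≡0 : K⁺ (m s) d (3 ℕ.+ w) ≡ 0ℤ
    K⁺≡0 = *-cancelʳ (K-positive w (ℕ.n≤1+n w) (truncate (ℕ.n≤1+n w) W′))
      (trans (sym (entry⁺ (1 ℕ.+ w) ℕ.≤-refl W′))
        (trans (cong (d 0 *_) (zeroʳ s)) (*-zeroʳ (d 0))))
    g = K (tail d) (1 ℕ.+ w)
    m≡ : m s ≡ g * d 0
    m≡ = begin
      m s                              ≡⟨ eq (m s) (d 0) g ⟩
      (m s * 1ℤ - d 0 * g) + g * d 0   ≡⟨ cong (λ t → (m s * t - d 0 * g) + g * d 0) (K[2+w]≡1 W) ⟨
      K⁺ (m s) d (3 ℕ.+ w) + g * d 0   ≡⟨ cong (_+ g * d 0) K⁺≡0 ⟩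
      0ℤ + g * d 0                     ≡⟨ +-identityˡ _ ⟩
      g * d 0                          ∎
      where
      open ≡-Reasoning
      eq : ∀ m x g → m ≡ (m * 1ℤ - x * g) + g * x
      eq = solve-∀

  -- Extension by one index to the left: integrality and rescaling

  module Extension {s L d} (1≤L : 1 ℕ.≤ L) (L≤1+w : L ℕ.≤ 1 ℕ.+ w)
                   (W : Window (s + + 1) L d) where

    0<d₀ : 0ℤ < d 0
    0<d₀ = positive′ W 1≤L

    0<m : 0ℤ < m s
    0<m = 0<1+y s {1} (s≤s z≤n)

    -- The ideal of all z such that (m s / d 0) z is an integer.
    Clears : ℤ → Set
    Clears z = d 0 ∣ m s * z

    linear : ∀ {x y} a b → Clears x → Clears y → Clears (a * x + b * y)
    linear {x} {y} a b x∈ y∈ = subst (d 0 ∣_) (eq (m s) a b x y)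
      (∣m∣n⇒∣m+n (∣n⇒∣m*n a x∈) (∣n⇒∣m*n b y∈))
      where
      eq : ∀ m a b x y → a * (m * x) + b * (m * y) ≡ m * (a * x + b * y)
      eq = solve-∀

    -- Integrality of the Y-frieze enters here: `relation⁺` rewrites m f f′ as `d 0` times an
    -- integer built from `y s (1 + k)`.
    consecutive : ∀ k → k ℕ.≤ L → Clears (K d k * K d (1 ℕ.+ k))
    consecutive 0 _ = divides 0ℤ (eq (m s))
      where
      eq : ∀ m → m * (0ℤ * 1ℤ) ≡ 0ℤ
      eq = solve-∀
    consecutive (suc k) k< = divides (1ℤ + y s (1 ℕ.+ k) + g * f′) (begin
      m s * (f * f′)
        ≡⟨ e₁ (m s) (d 0) f f′ g ⟩
      (m s * f - d 0 * g) * f′ + g * f′ * d 0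
        ≡⟨ cong (_+ g * f′ * d 0) (relation⁺ (suc k) (ℕ.≤-trans k< L≤1+w) (truncate k< W)) ⟨
      d 0 * (1ℤ + y s (1 ℕ.+ k)) + g * f′ * d 0
        ≡⟨ e₂ (d 0) (1ℤ + y s (1 ℕ.+ k)) (g * f′) ⟩
      (1ℤ + y s (1 ℕ.+ k) + g * f′) * d 0 ∎)
      where
      open ≡-Reasoning
      f = K d (1 ℕ.+ k)
      f′ = K d (2 ℕ.+ k)
      g = K (tail d) k
      e₁ : ∀ m x f f′ g → m * (f * f′) ≡ (m * f - x * g) * f′ + g * f′ * x
      e₁ = solve-∀
      e₂ : ∀ x u v → x * u + v * x ≡ (u + v) * x
      e₂ = solve-∀

    -- Modulo this ideal K d k K d (k + 1) vanishes, so inductively K d k ≡ 0 and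
    -- K d (k + 1)² ≡ 1 for even k, whence d k ≡ 0.
    mutual
      K-even : ∀ j → j ℕ.* 2 ℕ.≤ L →
               Clears (K d (j ℕ.* 2)) ×
               Clears (K d (1 ℕ.+ j ℕ.* 2) * K d (1 ℕ.+ j ℕ.* 2) - 1ℤ)
      K-even zero _ = divides 0ℤ (*-zeroʳ (m s)) , divides 0ℤ (*-zeroʳ (m s))
      K-even (suc j) 2+k≤L =
        f₂∈ ,
        subst Clears (e₂ f₁ f₂ (d (1 ℕ.+ k)))
          (linear (f₂ * d (1 ℕ.+ k) * d (1 ℕ.+ k) - + 2 * f₁ * d (1 ℕ.+ k)) 1ℤ f₂∈ f₁²∈)
        where
        k = j ℕ.* 2
        f₀ = K d k
        f₁ = K d (1 ℕ.+ k)
        f₂ = K d (2 ℕ.+ k)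
        k<L = ℕ.≤-trans (ℕ.n≤1+n _) 2+k≤L
        ih = K-even j (ℕ.<⇒≤ k<L)
        f₁²∈ = proj₂ ih
        f₂∈ : Clears f₂
        f₂∈ = subst Clears (e₁ f₀ f₁ (d k)) (linear f₁ (- 1ℤ) (d-even j k<L) (proj₁ ih))
          where
          e₁ : ∀ f₀ f₁ x → f₁ * x + - 1ℤ * f₀ ≡ f₁ * x - f₀
          e₁ = solve-∀
        e₂ : ∀ f₁ f₂ z → (f₂ * z * z - + 2 * f₁ * z) * f₂ + 1ℤ * (f₁ * f₁ - 1ℤ) ≡
                         (f₂ * z - f₁) * (f₂ * z - f₁) - 1ℤ
        e₂ = solve-∀

      d-even : ∀ j → j ℕ.* 2 ℕ.< L → Clears (d (j ℕ.* 2))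
      -- With f₂ = f₁ x - f₀, which is `K d (2 + k)`, one has x = f₁ f₂ + f₁ f₀ - x (f₁² - 1), and
      -- every summand lies in the ideal.
      d-even j k<L = subst Clears (eq f₀ f₁ (d k))
        (linear 1ℤ 1ℤ (consecutive (1 ℕ.+ k) k<L)
          (linear f₁ (- d k) (proj₁ ih) (proj₂ ih)))
        where
        k = j ℕ.* 2
        f₀ = K d k
        f₁ = K d (1 ℕ.+ k)
        ih = K-even j (ℕ.<⇒≤ k<L)
        eq : ∀ f₀ f₁ x → 1ℤ * (f₁ * (f₁ * x - f₀)) +
                         1ℤ * (f₁ * f₀ + - x * (f₁ * f₁ - 1ℤ)) ≡ x
        eq = solve-∀

    module Rescaling {g e n} (0<g : 0ℤ < g) (d₀≡ : d 0 ≡ e * g) (m≡ : m s ≡ n * g)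
                     (coprime : Coprime e n) where

      0<e : 0ℤ < e
      0<e = *-pos-cancelʳ (subst (0ℤ <_) d₀≡ 0<d₀) 0<g
      0<n : 0ℤ < n
      0<n = *-pos-cancelʳ (subst (0ℤ <_) m≡ 0<m) 0<g

      -- Cancelling g leaves e dividing n z, and e is coprime to n.
      e∣ : ∀ {z} → Clears z → e ∣ z
      e∣ {z} z∈ = ∣ᵤ⇒∣ (coprime-divisor e n z coprime (∣⇒∣ᵤ {e} {n * z}
        (*-cancelʳ-∣ g {e} {n * z} ⦃ >-nonZero 0<g ⦄
          (subst₂ _∣_ d₀≡ (trans (cong (_* z) m≡) (eq n g z)) z∈))))
        where
        eq : ∀ n g z → n * g * z ≡ n * z * g
        eq = solve-∀

      -- The rescaling factor at k is (ρ k)² / e, that is 1/e or e according to parity.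
      ρ : ℕ → ℤ
      ρ 0             = 1ℤ
      ρ 1             = e
      ρ (suc (suc k)) = ρ k

      ρ-product : ∀ k → ρ k * ρ (suc k) ≡ e
      ρ-product 0             = *-identityˡ e
      ρ-product 1             = *-identityʳ e
      ρ-product (suc (suc k)) = ρ-product k

      ρ-even : ∀ j → ρ (j ℕ.* 2) ≡ 1ℤ
      ρ-even zero    = refl
      ρ-even (suc j) = ρ-even j

      ρ-odd : ∀ j → ρ (1 ℕ.+ j ℕ.* 2) ≡ e
      ρ-odd zero    = refl
      ρ-odd (suc j) = ρ-odd j

      Rescaled : ℕ → ℤ → Set
      Rescaled k x = x * e ≡ ρ k * ρ k * d k

      rescale : ∀ k → k ℕ.< L → ∃ (Rescaled k)
      rescale k k<L = byParity (parity k)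
        where
        swapˡ : ∀ e x → e * x * e ≡ e * e * x
        swapˡ = solve-∀
        byParity : (∃ λ j → k ≡ j ℕ.* 2) ⊎ (∃ λ j → k ≡ 1 ℕ.+ j ℕ.* 2) → ∃ (Rescaled k)
        byParity (inj₁ (j , refl)) = quotient e∣d , trans (sym (equality e∣d))
          (trans (sym (*-identityˡ _)) (cong (λ r → r * r * d k) (sym (ρ-even j))))
          where e∣d = e∣ (d-even j k<L)
        byParity (inj₂ (j , refl)) = e * d k ,
          trans (swapˡ e (d k)) (cong (λ r → r * r * d k) (sym (ρ-odd j)))

      chosen = choice L rescale
      d′ = proj₁ chosen

      rescaled : ∀ {k} → k ℕ.< L → Rescaled k (d′ k)
      rescaled = proj₂ chosen

      0<ρ : ∀ k → 0ℤ < ρ k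
      0<ρ 0             = 0<1
      0<ρ 1             = 0<e
      0<ρ (suc (suc k)) = 0<ρ k

      W′ : Window (s + + 1) L d′
      W′ = record
        { positive′ = λ {k} k<L → *-pos-cancelʳ
            (subst (0ℤ <_) (sym (rescaled k<L))
              (*-pos (*-pos (0<ρ k) (0<ρ k)) (positive′ W k<L))) 0<e
        -- After multiplication by e², the neighbouring factors (ρ k)² and (ρ (k + 1))² contribute
        -- exactly e², so products of neighbours do not change.
        ; product = λ {k} k<L → *-cancelʳ (*-pos 0<e 0<e) (begin
            d′ k * d′ (suc k) * (e * e)
              ≡⟨ swap (d′ k) (d′ (suc k)) e e ⟩
            d′ k * e * (d′ (suc k) * e)
              ≡⟨ cong₂ _*_ (rescaled (ℕ.<⇒≤ k<L)) (rescaled k<L) ⟩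
            ρ k * ρ k * d k * (ρ (suc k) * ρ (suc k) * d (suc k))
              ≡⟨ regroup (ρ k) (ρ (suc k)) (d k) (d (suc k)) ⟩
            d k * d (suc k) * (ρ k * ρ (suc k) * (ρ k * ρ (suc k)))
              ≡⟨ cong₂ (λ u v → u * (v * v)) (product W k<L) (ρ-product k) ⟩
            m (s + + 1 + + k) * (e * e) ∎) }
        where
        open ≡-Reasoning
        swap : ∀ p q r t → p * q * (r * t) ≡ p * r * (q * t)
        swap = solve-∀
        regroup : ∀ r r′ x x′ → r * r * x * (r′ * r′ * x′) ≡ x * x′ * (r * r′ * (r * r′))
        regroup = solve-∀

      -- Rescaling replaces `d 0` by g, so the missing entry m/d becomes the integer n.
      nd′₀ : n * d′ 0 ≡ m s
      nd′₀ = trans (cong (n *_) d′₀≡g) (sym m≡)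
        where
        d′₀≡g : d′ 0 ≡ g
        d′₀≡g = *-cancelʳ 0<e (trans (rescaled 1≤L)
          (trans (*-identityˡ (d 0)) (trans d₀≡ (*-comm e g))))

      extended : ∃ (Window s (suc L))
      extended = n ∷ d′ , consWindow 0<n nd′₀ W′

    extend : ∃ (Window s (suc L))
    extend = byLowestTerms (lowestTerms 0<d₀ 0<m)
      where
      byLowestTerms : (∃ λ g → ∃ λ e → ∃ λ n →
        0ℤ < g × d 0 ≡ e * g × m s ≡ n * g × Coprime e n) → ∃ (Window s (suc L))
      byLowestTerms (g , e , n , 0<g , d₀≡ , m≡ , coprime) =
        Rescaling.extended {g} {e} {n} 0<g d₀≡ m≡ coprime

  -- Full windows and their leftward continuation

  window : ∀ L s → L ℕ.≤ 1 ℕ.+ w → ∃ (Window s (suc L))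
  -- A single entry satisfies no product condition, so any positive value can start the induction.
  window zero s _ = (λ _ → 1ℤ) , record
    { positive′ = λ _ → 0<1 ; product = λ { (s≤s ()) } }
  window (suc L) s L< =
    Extension.extend (s≤s z≤n) L< (proj₂ (window L (s + + 1) (ℕ.<⇒≤ L<)))

  module Leftward {s d} (W : Window s (2 ℕ.+ w) d) where

    slides : ℕ → Stream
    slides zero    = d
    slides (suc j) = slide (slides j)

    slidesWindow : ∀ j → Window (s - + j) (2 ℕ.+ w) (slides j)
    slidesWindow zero    = subst (λ t → Window t _ d) (sym (+-identityʳ s)) W
    slidesWindow (suc j) = slideWindow
      (subst (λ t → Window t _ (slides j)) (eq s (+ j)) (slidesWindow j))
      where
      eq : ∀ s j → s - j ≡ s - (+ 1 + j) + + 1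
      eq = solve-∀

    slides-shift : ∀ k j → slides (k ℕ.+ j) k ≡ slides j 0
    slides-shift zero    j = refl
    slides-shift (suc k) j = slides-shift k j

    C : Stream
    C j = slides j 0

    C-positive : ∀ j → 0ℤ < C j
    C-positive j = positive′ (slidesWindow j) (s≤s z≤n)

    C-product : ∀ j → C (suc j) * C j ≡ m (s - + suc j)
    C-product j = firstProduct (s≤s (s≤s z≤n)) (slidesWindow (suc j))

    -- The head of `slides (3 + w + j)` is `K (slides (1 + w + j)) (1 + w)`. By `lastEntry` this is
    -- the last entry of that window, which is the head of `slides j` moved right by 1 + w slides.
    C-periodic : ∀ j → C (3 ℕ.+ w ℕ.+ j) ≡ C j
    C-periodic j = trans (sym (lastEntry (slidesWindow (1 ℕ.+ w ℕ.+ j))))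
                         (slides-shift (1 ℕ.+ w) j)

  -- `C j` is the value at index s - j.
  record LeftwardSolution (s : ℤ) (C : Stream) : Set where
    field
      C-positive : ∀ j → 0ℤ < C j
      C-product  : ∀ j → C (suc j) * C j ≡ m (s - + suc j)
      C-periodic : ∀ j → C (3 ℕ.+ w ℕ.+ j) ≡ C j

  leftwardSolution : ∀ s → ∃ (LeftwardSolution s)
  leftwardSolution s = C , record
    { C-positive = C-positive ; C-product = C-product ; C-periodic = C-periodic }
    where open Leftward (proj₂ (window (1 ℕ.+ w) s ℕ.≤-refl))

  -- Periodicity and the two-sided sequence

  m-periodic : ∀ t → m (t + + (3 ℕ.+ w)) ≡ m t
  m-periodic t = fromSolution (leftwardSolution s)
    where
    -- Starting this far to the right puts both t and t + w + 3 in the range of the leftward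
    -- products.
    s = t + + (4 ℕ.+ w)
    e₁ : ∀ t w → t + (+ 4 + w) - + 1 ≡ t + (+ 3 + w)
    e₁ = solve-∀
    e₂ : ∀ t w → t + (+ 4 + w) - (+ 4 + w) ≡ t
    e₂ = solve-∀
    fromSolution : ∃ (LeftwardSolution s) → m (t + + (3 ℕ.+ w)) ≡ m t
    fromSolution (C , S) = begin
      m (t + + (3 ℕ.+ w))             ≡⟨ cong m (e₁ t (+ w)) ⟨
      m (s - + 1)                     ≡⟨ C-product 0 ⟨
      C 1 * C 0                       ≡⟨ cong₂ _*_ C₁≡ C₀≡ ⟨
      C (4 ℕ.+ w) * C (3 ℕ.+ w)       ≡⟨ C-product (3 ℕ.+ w) ⟩
      m (s - + (4 ℕ.+ w))             ≡⟨ cong m (e₂ t (+ w)) ⟩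
      m t                             ∎
      where
      open ≡-Reasoning
      open LeftwardSolution S
      C₀≡ : C (3 ℕ.+ w) ≡ C 0
      C₀≡ = trans (cong (λ k → C (3 ℕ.+ k)) (sym (ℕ.+-identityʳ w))) (C-periodic 0)
      C₁≡ : C (4 ℕ.+ w) ≡ C 1
      C₁≡ = trans (cong (λ k → C (3 ℕ.+ k)) (ℕ.+-comm 1 w)) (C-periodic 1)

  m-periodic* : ∀ k t → m (t + + (k ℕ.* (3 ℕ.+ w))) ≡ m t
  m-periodic* zero    t = cong m (+-identityʳ t)
  m-periodic* (suc k) t = trans
    (cong m (sym (+-assoc t (+ (3 ℕ.+ w)) (+ (k ℕ.* (3 ℕ.+ w))))))
    (trans (m-periodic* k (t + + (3 ℕ.+ w))) (m-periodic t))

  module TwoSided {C} (S : LeftwardSolution 0ℤ C) where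
    open LeftwardSolution S

    -- By periodicity of C, index k ≥ 0 may be read off at -k (n - 1), where n = w + 3.
    c : ℤ → ℤ
    c (+ k)    = C (k ℕ.* (2 ℕ.+ w))
    c -[1+ j ] = C (suc j)

    c-positive : ∀ i → 0ℤ < c i
    c-positive (+ k)    = C-positive (k ℕ.* (2 ℕ.+ w))
    c-positive -[1+ j ] = C-positive (suc j)

    c-product : ∀ i → c i * c (i + + 1) ≡ m i
    c-product -[1+ zero ]  = C-product 0
    c-product -[1+ suc j ] = C-product (suc j)
    -- Adding one period to the position kr makes it adjacent to r + kr, the position of index k +
    -- 1. The resulting argument of `m` differs from k by k + 1 periods.
    c-product (+ k) rewrite ℕ.+-comm k 1 = begin
      C kr * C (r ℕ.+ kr)                           ≡⟨ cong (_* C (r ℕ.+ kr)) (C-periodic kr) ⟨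
      C (suc (r ℕ.+ kr)) * C (r ℕ.+ kr)             ≡⟨ C-product (r ℕ.+ kr) ⟩
      m (0ℤ - + X)                                  ≡⟨ m-periodic* (suc k) (0ℤ - + X) ⟨
      m (0ℤ - + X + + (suc k ℕ.* suc r))            ≡⟨ cong (λ t → m (0ℤ - + X + + t)) (expand k r) ⟩
      m (0ℤ - + X + (+ k + + X))                    ≡⟨ cong m (cancel (+ k) (+ X)) ⟩
      m (+ k)                                       ∎
      where
      open ≡-Reasoning
      r = 2 ℕ.+ w
      kr = k ℕ.* r
      X = suc (r ℕ.+ kr)
      expand : ∀ k p → suc k ℕ.* suc p ≡ k ℕ.+ suc (p ℕ.+ k ℕ.* p)
      expand = ℕ-Solver.solve-∀
      cancel : ∀ k x → 0ℤ - x + (k + x) ≡ k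
      cancel = solve-∀

  twoSidedSolution : ∃ λ c → (∀ i → 0ℤ < c i) × (∀ i → c i * c (i + + 1) ≡ m i)
  twoSidedSolution = fromSolution (leftwardSolution 0ℤ)
    where
    fromSolution : ∃ (LeftwardSolution 0ℤ) →
                   ∃ λ c → (∀ i → 0ℤ < c i) × (∀ i → c i * c (i + + 1) ≡ m i)
    fromSolution (_ , S) = c , c-positive , c-product
      where open TwoSided S

-- The frieze of a two-sided sequence

from : (ℤ → ℤ) → ℤ → Stream
from c i k = c (i + + k)

module Array (c : ℤ → ℤ) where

  U : ℤ → ℕ → ℤ
  U i = K (from c i)

  U-tail : ∀ i k → K (tail (from c i)) k ≡ U (i + + 1) k
  U-tail i = K-cong (λ k → cong c (sym (+-assoc i (+ 1) (+ k))))

  -- `U` continued one place backwards by its recursion, so that index 0 holds the border -1 at j -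
  -- i = -3. Negative indices lie outside the strip and default to 0.
  V : ℤ → ℤ → ℤ
  V i (+ zero)  = -1ℤ
  V i (+ suc k) = U i k
  V i -[1+ _ ]  = 0ℤ

  V-diamond : ∀ i k → U i k * U (i + + 1) k ≡ 1ℤ + U i (1 ℕ.+ k) * V (i + + 1) (+ k)
  V-diamond i zero    = refl
  V-diamond i (suc k) rewrite sym (U-tail i k) | sym (U-tail i (suc k)) =
    K-diamond (from c i) k

  a : ℤ → ℤ → ℤ
  a i j = V i (j - i + + 3)

  at : ∀ i j {k} → j - i + + 3 ≡ k → a i j ≡ V i k
  at i _ = cong (V i)

  -- `q` is w + 2, a natural number even for w = -1. The last border value -1 follows by the
  -- recursion from the values 1 and 0 before it.
  isFrieze : ∀ {w} q → w + + 3 ≡ + suc q →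
             (∀ i → U i q ≡ 1ℤ) → (∀ i → U i (1 ℕ.+ q) ≡ 0ℤ) →
             (∀ i k → 2 ℕ.+ k ℕ.< q → 0ℤ < U i (2 ℕ.+ k)) → IsFrieze w a
  isFrieze {w} q w+3≡ one zero′ positive = record
    { [i,i-3]   = λ i → at i (i - + 3) (e₁ i (- + 3))
    ; [i,i-2]   = λ i → at i (i - + 2) (e₁ i (- + 2))
    ; [i,i-1]   = λ i → at i (i - + 1) (e₁ i (- + 1))
    ; [i,i+w]   = λ i → trans (at i (i + w) (trans (e₁ i w) w+3≡)) (one i)
    ; [i,i+w+1] = λ i → trans (at i (i + w + + 1) (e₂ i (+ 1))) (zero′ i)
    ; [i,i+w+2] = λ i → trans (at i (i + w + + 2) (e₂ i (+ 2)))
                    (cong₂ (λ u v → u * c (i + + q) - v) (zero′ i) (one i))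
    ; pos       = λ i j 0≤ ≤w-1 → pos′ i j (j - i) refl 0≤ ≤w-1
    ; diamond   = λ i j -2≤ _ → diamond′ i j (j - i + + 2) refl (+-monoˡ-≤ (+ 2) -2≤)
    }
    where
    e₁ : ∀ i w → (i + w) - i + + 3 ≡ w + + 3
    e₁ = solve-∀
    e₂ : ∀ i k → (i + w + k) - i + + 3 ≡ k + + suc q
    e₂ i k = trans (eq i w k) (cong (λ t → k + t) w+3≡)
      where
      eq : ∀ i w k → (i + w + k) - i + + 3 ≡ k + (w + + 3)
      eq = solve-∀

    pos′ : ∀ i j δ → j - i ≡ δ → 0ℤ ≤ δ → δ ≤ w - + 1 → 0ℤ < a i j
    pos′ i j (+ t) eq _ t≤ = subst (0ℤ <_)
      (sym (at i j (trans (cong (_+ + 3) eq) (+-comm (+ t) (+ 3)))))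
      (positive i t (ℕ.≤-pred (drop‿+≤+ (subst₂ _≤_ (+-comm (+ t) (+ 4))
        (trans (shift w) w+3≡) (+-monoˡ-≤ (+ 4) t≤)))))
      where
      shift : ∀ w → w - + 1 + + 4 ≡ w + + 3
      shift = solve-∀

    diamond′ : ∀ i j δ → j - i + + 2 ≡ δ → 0ℤ ≤ δ →
               a i j * a (i + + 1) (j + + 1) ≡ 1ℤ + a i (j + + 1) * a (i + + 1) j
    diamond′ i j (+ t) eq _ = begin
      a i j * a (i + + 1) (j + + 1)
        ≡⟨ cong₂ _*_ (at i j (trans (s₁ i j) (cong (λ z → + 1 + z) eq)))
                     (at (i + + 1) (j + + 1) (trans (s₂ i j) (cong (λ z → + 1 + z) eq))) ⟩
      U i t * U (i + + 1) t
        ≡⟨ V-diamond i t ⟩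
      1ℤ + U i (1 ℕ.+ t) * V (i + + 1) (+ t)
        ≡⟨ cong₂ (λ u v → 1ℤ + u * v) (at i (j + + 1) (trans (s₃ i j) (cong (λ z → + 2 + z) eq)))
                                      (at (i + + 1) j (trans (s₄ i j) eq)) ⟨
      1ℤ + a i (j + + 1) * a (i + + 1) j ∎
      where
      open ≡-Reasoning
      s₁ : ∀ i j → j - i + + 3 ≡ + 1 + (j - i + + 2)
      s₁ = solve-∀
      s₂ : ∀ i j → (j + + 1) - (i + + 1) + + 3 ≡ + 1 + (j - i + + 2)
      s₂ = solve-∀
      s₃ : ∀ i j → (j + + 1) - i + + 3 ≡ + 2 + (j - i + + 2)
      s₃ = solve-∀
      s₄ : ∀ i j → j - (i + + 1) + + 3 ≡ j - i + + 2
      s₄ = solve-∀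

  a-diagonal : ∀ i → a i (i + + 1) ≡ c i * c (i + + 1) - 1ℤ
  a-diagonal i = trans (at i (i + + 1) (e i))
    (trans (s (c (i + + 0)) (c (i + + 1)))
           (cong (λ z → c z * c (i + + 1) - 1ℤ) (+-identityʳ i)))
    where
    e : ∀ i → (i + + 1) - i + + 3 ≡ + 4
    e = solve-∀
    s : ∀ x y → (1ℤ * x - 0ℤ) * y - 1ℤ ≡ x * y - 1ℤ
    s = solve-∀

-- Surjectivity

strip : ∀ {w} (B : YFrieze (+ w)) →
        YStrip w (λ s k → YFrieze.entry B s (s + + k - + 1))
strip {w} B = record
  { zeroˡ   = λ s → trans (cong (b s) (cong (_- + 1) (+-identityʳ s))) ([i,i-1] s)
  ; zeroʳ   = λ s → trans (cong (b s) (e₁ s (+ w))) ([i,i+w] s)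
  ; pos     = λ s {k} k<w → pos s _ (subst (0ℤ ≤_) (sym (e₂ s (+ k))) (+≤+ z≤n))
                (subst (_≤ + w - + 1) (sym (e₂ s (+ k))) (+-monoˡ-≤ (- + 1) (+≤+ k<w)))
  ; diamond = λ s {k} k<w → trans
      (cong (λ j → b s (s + + suc k - + 1) * b (s + + 1) j) (e₃ s (+ k)))
      (trans (diamond s (s + + suc k - + 1)
               (subst (- + 2 ≤_) (sym (e₂ s (+ k))) -≤+)
               (subst (_≤ + w + + 1) (sym (e₂ s (+ k)))
                 (+≤+ (ℕ.≤-trans (ℕ.<⇒≤ k<w) (ℕ.m≤m+n w 1)))))
        (cong₂ (λ j j′ → (1ℤ + b s j) * (1ℤ + b (s + + 1) j′)) (e₄ s (+ k)) (e₅ s (+ k))))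
  }
  where
  open YFrieze B renaming (entry to b)
  e₁ : ∀ s w → s + (+ 1 + w) - + 1 ≡ s + w
  e₁ = solve-∀
  e₂ : ∀ s k → s + (+ 1 + k) - + 1 - s ≡ k
  e₂ = solve-∀
  e₃ : ∀ s k → s + + 1 + (+ 1 + k) - + 1 ≡ s + (+ 1 + k) - + 1 + + 1
  e₃ = solve-∀
  e₄ : ∀ s k → s + (+ 1 + k) - + 1 + + 1 ≡ s + (+ 2 + k) - + 1
  e₄ = solve-∀
  e₅ : ∀ s k → s + (+ 1 + k) - + 1 ≡ s + + 1 + k - + 1
  e₅ = solve-∀

preimage : ∀ {w} → -1ℤ ≤ w → (B : YFrieze w) → ∃ λ (A : Frieze w) → A MapsTo B
-- In width -1 the entries a_{i,i} lie on the zero border, so c is constantly 0, and 0 · 0 - 1 is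
-- the border value b_{i,i} = -1.
preimage { -[1+ zero ]} _ B =
  (a , isFrieze 1 refl (λ _ → refl) (λ _ → refl) (λ { _ _ (s≤s ()) })) ,
  λ i → trans (trans (cong (b i) (eq i)) ([i,i+w+1] i)) (sym (a-diagonal i))
  where
  open YFrieze B using ([i,i+w+1]) renaming (entry to b)
  open Array (λ _ → 0ℤ)
  eq : ∀ i → i ≡ i - + 1 + + 1
  eq = solve-∀
preimage { -[1+ suc _ ]} (-≤- ()) _
preimage {+ w} _ B = fromSolution twoSidedSolution
  where
  open YFrieze B using () renaming (entry to b)
  open Strip (strip B)
  eq : ∀ x → x ≡ 1ℤ + x - 1ℤ
  eq = solve-∀
  e : ∀ i → i ≡ i + + 1 - + 1
  e = solve-∀
  fromSolution : (∃ λ c → (∀ i → 0ℤ < c i) × (∀ i → c i * c (i + + 1) ≡ m i)) →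
                 ∃ λ (A : Frieze (+ w)) → A MapsTo B
  fromSolution (c , c-positive , c-product) =
    (a , isFrieze (2 ℕ.+ w) (cong +_ (ℕ.+-comm w 3))
           (λ i → K[2+w]≡1 (W i)) (λ i → K[3+w]≡0 (W i))
           (λ { i k (s≤s k<) → K-positive (suc k) (ℕ.<⇒≤ k<) (W i) })) ,
    λ i → trans (eq (b i i)) (trans (cong (_- 1ℤ) (trans
      (cong (λ j → 1ℤ + b i j) (e i)) (sym (c-product i)))) (sym (a-diagonal i)))
    where
    open Array c
    W : ∀ {L} i → Window i L (from c i)
    W i = record
      { positive′ = λ {k} _ → c-positive (i + + k)
      ; product   = λ {k} _ → trans (cong (λ j → c (i + + k) * c j) (s i (+ k)))
                                    (c-product (i + + k)) }
      where
      s : ∀ i k → i + (+ 1 + k) ≡ i + k + + 1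
      s = solve-∀

theoremA : (w : ℤ) → -1ℤ ≤ w → StrictlySurjective (_≈Y_ {w}) (p {w})
theoremA w -1≤w B with preimage -1≤w B
... | A , A↦B = A , proj₂ (proj₂ (∃!-image A)) {B} A↦B
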